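{- Let $(G,X,H,f)$ be a constructible configuration, let $B$ be a block of $G$, let $f^B$ be the $B$-part of $f$, and let $\mathfrak{C}^B=(B,X^B,H^B,f^B)$, where $X^B$ is the restriction of $X$ to $V(B)$ and $H^B=H[\bigcup_{v\in V(B)}X_v]$. Suppose that there is a pair $u,v$ of distinct vertices of $B$ such that $H(X_u,X_v)=H[X_u\cup X_v]$ has only one component. Then $\mathfrak{C}^B$ is an M-configuration, and if $u,v$ are (any) distinct vertices of $B$ with $\mu_G(u,v)=m>0$, then $H(X_u,X_v)$ is a $tK_{s,s}$ with $m=ts$ for some $s,t\in\mathbb{N}$.
   Context: $\mathbb{N}=\{1,2,\dots\}$, $\mathbb{N}_0=\mathbb{N}\cup\{0\}$. Graphs are finite, undirected, may have multiple edges, no loops; connected graphs are non-empty. $\mu_G(u,v)$ is the number of edges joining $u,v$; $d_G(v)$ is the number of edges incident with $v$. $tG$ has vertex set $V(G)$ and $\mu_{tG}=t\mu_G$. $K_n$, $C_n$ ($n\ge3$), $K_{s,s}$ are the simple complete graph, cycle, complete bipartite graph. A block of a graph is a maximal connected subgraph $B$ that has no separating vertex (vertex whose deletion from $B$ leaves at least two components); $G$ is a block if it is its own only block. Covers. A cover of $G$ is a pair $(X,H)$, $H$ a graph, $X$ assigning to each $v\in V(G)$ a set $X_v\subseteq V(H)$, such that the $X_v$ are pairwise disjoint with union $V(H)$, each $X_v$ is independent in $H$, and for distinct $u,v\in V(G)$ the set of edges of $H$ between $X_u$ and $X_v$ is the union of $\mu_G(u,v)$ (possibly empty) matchings. For $U\subseteq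 V(H)$ put $X_v(U)=X_v\cap U$; $(X,H)/U$ is the cover $(X',H[U])$ of $G[\{v: X_v(U)\ne\varnothing\}]$ with $X'_v=X_v(U)$. Configurations. A configuration is a tuple $(G,X,H,f)$ with $(X,H)$ a cover of the graph $G$ and $f:V(H)\to\mathbb{N}_0$. It is uniform if for some $r\ge1$ all $|X_v|=r$. Special covers (all up to renaming vertices of the cover graph). A $G$-cover is a cover with $X_v=\{x_v\}$ for all $v$ and $\mu_H(x_u,x_v)=\mu_G(u,v)$ for all distinct $u,v$. For $G=tC_n$ with $C_n=(v_1,\dots,v_n,v_1)$, a double $G$-cover is a cover with $X_{v_i}=\{x_i,x_{n+i}\}$ ($1\le i\le n$), $\mu_H(x_i,x_j)=t$ if $i-j\equiv\pm1 \pmod{2n}$ and $\mu_H(x_i,x_j)=0$ otherwise. If $s\in\mathbb{N}$ divides all multiplicities $\mu_H(x,y)$, the $s$-inflation of $(X,H)$ is the cover $(\tilde X,\tilde H)$ of $G$ obtained by replacing every $x\in V(H)$ by a set $U_x$ of $s$ new vertices, with $\tilde X_v=\bigcup_{x\in X_v}U_x$, and for distinct $x,y\in V(H)$ placing a copy of $mK_{s,s}$ with parts $U_x,U_y$, where $m=\mu_H(x,y)/s$. An inflation is an $s$-inflation for some $s\in\mathbb{N}$. Constructible configurations. The family of constructible configurations is defined recursively: a uniform configuration $(G,X,H,f)$ is constructible if one of the following holds. (K1) M-configuration: $G$ is a block and there is $U\subseteq V(H)$ such that $(X,H)/U$ is an inflation of a $G$-cover, and for $v\in V(G)$, $x\in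 X_v$: $f(x)=d_G(v)/|X_v(U)|$ if $x\in U$, else $f(x)=0$. (K2) K-configuration: $G=tK_n$ with $t,n\in\mathbb{N}$ and there are $p\ge1$, $n_1,\dots,n_p\in\mathbb{N}$ with $n_1+\dots+n_p=n-1$ and pairwise disjoint $U_1,\dots,U_p\subseteq V(H)$ such that each $(X,H)/U_i$ is an inflation of a $G$-cover, and for $v\in V(G)$, $x\in X_v$: $f(x)=tn_i/|X_v(U_i)|$ if $x\in U_i$ for some $i$, else $f(x)=0$. (K3) Odd C-configuration: $G=tC_n$ with $t\in\mathbb{N}$, $n\ge3$ odd, and there are disjoint $U_1,U_2\subseteq V(H)$ such that each $(X,H)/U_i$ is an inflation of a $G$-cover, and for $v\in V(G)$, $x\in X_v$: $f(x)=t/|X_v(U_i)|$ if $x\in U_i$ for $i\in\{1,2\}$, else $f(x)=0$. (K4) Even C-configuration: $G=tC_n$ with $t\in\mathbb{N}$, $n\ge4$ even, and there is $U\subseteq V(H)$ such that $(X,H)/U$ is an inflation of a double $G$-cover, and for $v\in V(G)$, $x\in X_v$: $f(x)=2t/|X_v(U)|$ if $x\in U$, else $f(x)=0$. (K5) There are two disjoint constructible configurations $(G^1,X^1,H^1,f^1)$, $(G^2,X^2,H^2,f^2)$ such that $G$ is obtained from the disjoint graphs $G^1,G^2$ by identifying a vertex $v^1\in V(G^1)$ and a vertex $v^2\in V(G^2)$ to a new vertex $v^*$; $H$ is obtained from the disjoint graphs $H^1,H^2$ by choosing a bijection $\pi:X^1_{v^1}\to X^2_{v^2}$ and identifying each $x\in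 X^1_{v^1}$ with $\pi(x)$ to a vertex $x^*$ (so $X_{v^*}$ is the set of these $x^*$, and $X_v=X^i_v$ for other $v\in V(G^i)$); and $f(y)=f^i(y)$ for $y\in V(H^i)\setminus X^i_{v^i}$, $f(x^*)=f^1(x)+f^2(\pi(x))$ for $x\in X^1_{v^1}$. A C-configuration is an odd or an even C-configuration. $B$-parts. For a constructible configuration $(G,X,H,f)$ there is a unique family of functions $f^B:V(H^B)\to\mathbb{N}_0$, indexed by the blocks $B$ of $G$, such that each $(B,X^B,H^B,f^B)$ is an M-, K- or C-configuration and $f(x)=\sum_{B\ni v}f^B(x)$ (sum over blocks $B$ containing $v$) for all $v\in V(G)$, $x\in X_v$; $f^B$ is called the $B$-part of $f$. -}

module Defs where

open import Data.Bool.Base using (Bool; true; false; T; _∧_; _xor_; if_then_else_)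
open import Data.Bool.Properties using (∧-comm; ∨-comm; xor-comm; xor-same)
open import Data.Fin.Base using (Fin; toℕ; splitAt; _↑ˡ_; _↑ʳ_)
open import Data.Fin.Properties using (_≟_; any?)
open import Data.Fin.Subset using (Subset; _∈_; _∉_; _⊆_; _∩_; _∪_; _-_; ∣_∣; ⁅_⁆; ⊤; Nonempty; Empty)
open import Data.Fin.Subset.Properties using (_∈?_; ∈⊤; x∈p∩q⁺)
open import Data.List.Base as List using (List)
open import Data.List.Membership.Propositional using () renaming (_∈_ to _∈ₗ_)
open import Data.List.Relation.Unary.Unique.Propositional using (Unique)
open import Data.Nat.Base using (ℕ; zero; suc; _+_; _*_; _≤_) renaming (∣_-_∣ to dist)
open import Data.Nat.Divisibility using (_∣_; _∤_; _∣?_; ∣1⇒≡1)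
open import Data.Nat.ListAction using () renaming (sum to sumₗ)
open import Data.Nat.Properties using (+-0-commutativeMonoid; <⇒≤; >⇒≢; *-zeroʳ)
open import Data.Product.Base using (Σ-syntax; ∃-syntax; _×_; _,_; proj₁; proj₂)
open import Data.Sum.Base using (_⊎_; [_,_]′)
open import Data.Vec.Base using (tabulate; lookup)
open import Data.Vec.Properties using (lookup⇒[]=)
open import Function.Base using (_∘_; const)
open import Function.Bundles using (_⇔_; _↔_; Inverse)
open import Relation.Binary.Construct.Closure.ReflexiveTransitive using (Star)
open import Relation.Binary.PropositionalEquality using (_≡_; _≢_; refl; sym; trans; cong; subst)
open import Relation.Nullary using (¬_; Dec; yes; no; does; contradiction)
open import Relation.Nullary.Decidable using (_×-dec_; _⊎-dec_; dec-true; dec-false)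

open import Algebra.Properties.CommutativeMonoid.Sum +-0-commutativeMonoid public using (sum)

private
  variable
    n n₁ n₂ N N₁ N₂ : ℕ

------------------------------------------------------------------------
-- Finite multigraphs without loops

-- The vertices are drawn from an ambient set Fin n, so that subgraphs of a
-- graph live in the same type as the graph itself.

record Graph (n : ℕ) : Set where
  field
    V         : Subset n
    μ         : Fin n → Fin n → ℕ
    symmetric : ∀ u v → μ u v ≡ μ v u
    loopless  : ∀ v → μ v v ≡ 0
    support   : ∀ {u v} → μ u v ≢ 0 → u ∈ V

open Graph public

Vertex : Graph n → Set
Vertex G = ∃[ v ] v ∈ V G

degree : Graph n → Fin n → ℕ
degree G v = sum (μ G v)

record _≅_ (G : Graph n₁) (H : Graph n₂) : Set where
  field
    vertices  : Vertex G ↔ Vertex H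
    preserves : ∀ u v →
      μ H (proj₁ (Inverse.to vertices u)) (proj₁ (Inverse.to vertices v)) ≡ μ G (proj₁ u) (proj₁ v)

infix 4 _≅_

infix 4 _⊑_ _≈_

_⊑_ : Graph n → Graph n → Set
B ⊑ G = V B ⊆ V G × (∀ u v → μ B u v ≤ μ G u v)

_≈_ : Graph n → Graph n → Set
G ≈ H = G ⊑ H × H ⊑ G

infixl 9 _[_]

_[_] : Graph n → Subset n → Graph n
V (G [ W ]) = V G ∩ W
μ (G [ W ]) u v = if lookup W u ∧ lookup W v then μ G u v else 0
symmetric (G [ W ]) u v
  rewrite ∧-comm (lookup W u) (lookup W v) | symmetric G u v = refl
loopless (G [ W ]) v with lookup W v
... | true  = loopless G v
... | false = refl
support (G [ W ]) {u} {v} μ≢0 with lookup W u in eq | lookup W v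
... | true  | true  = x∈p∩q⁺ (support G μ≢0 , lookup⇒[]= u W eq)
... | true  | false = contradiction refl μ≢0
... | false | _     = contradiction refl μ≢0

infixr 8 _·_

_·_ : ℕ → Graph n → Graph n
V (t · G) = V G
μ (t · G) u v = t * μ G u v
symmetric (t · G) u v = cong (t *_) (symmetric G u v)
loopless (t · G) v = trans (cong (t *_) (loopless G v)) (*-zeroʳ t)
support (t · G) tμ≢0 = support G λ μ≡0 → tμ≢0 (trans (cong (t *_) μ≡0) (*-zeroʳ t))

complete : ∀ n → Graph n
V (complete n) = ⊤
μ (complete n) i j = if does (i ≟ j) then 0 else 1
symmetric (complete n) i j with i ≟ j | j ≟ i
... | yes _   | yes _   = refl
... | no  _   | no  _   = refl
... | yes i≡j | no  j≢i = contradiction (sym i≡j) j≢i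
... | no  i≢j | yes j≡i = contradiction (sym j≡i) i≢j
loopless (complete n) i rewrite dec-true (i ≟ i) refl = refl
support (complete n) _ = ∈⊤

-- Cyclic neighbours: i - j ≡ ±1 (mod k).

CyclicNeighbours : ∀ k → Fin k → Fin k → Set
CyclicNeighbours k i j = (k ∣ dist (suc (toℕ i)) (toℕ j)) ⊎ (k ∣ dist (suc (toℕ j)) (toℕ i))

cyclicNeighbours? : ∀ k (i j : Fin k) → Dec (CyclicNeighbours k i j)
cyclicNeighbours? k i j = (k ∣? dist (suc (toℕ i)) (toℕ j)) ⊎-dec (k ∣? dist (suc (toℕ j)) (toℕ i))

private
  dist-suc : ∀ m → dist (suc m) m ≡ 1
  dist-suc zero    = refl
  dist-suc (suc m) = dist-suc m

  ¬selfNeighbour : ∀ {k} → 3 ≤ k → (i : Fin k) → ¬ CyclicNeighbours k i i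
  ¬selfNeighbour {k} 3≤k i = [ absurd , absurd ]′
    where
    absurd : ¬ (k ∣ dist (suc (toℕ i)) (toℕ i))
    absurd k∣ = contradiction (∣1⇒≡1 (subst (k ∣_) (dist-suc (toℕ i)) k∣)) (>⇒≢ (<⇒≤ 3≤k))

cycle : ∀ n → 3 ≤ n → Graph n
V (cycle n _) = ⊤
μ (cycle n _) i j = if does (cyclicNeighbours? n i j) then 1 else 0
symmetric (cycle n _) i j = cong (λ b → if b then 1 else 0)
  (∨-comm (does (n ∣? dist (suc (toℕ i)) (toℕ j))) (does (n ∣? dist (suc (toℕ j)) (toℕ i))))
loopless (cycle n 3≤n) i
  rewrite dec-false (cyclicNeighbours? n i i) (¬selfNeighbour 3≤n i) = refl
support (cycle n _) _ = ∈⊤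

-- K_{s,s}, with parts { i ↑ˡ s } and { s ↑ʳ i }.

completeBipartite : ∀ s → Graph (s + s)
completeBipartite s = record
  { V         = ⊤
  ; μ         = λ i j → if side i xor side j then 1 else 0
  ; symmetric = λ i j → cong (λ b → if b then 1 else 0) (xor-comm (side i) (side j))
  ; loopless  = λ i → cong (λ b → if b then 1 else 0) (xor-same (side i))
  ; support   = λ _ → ∈⊤
  }
  where
  side : Fin (s + s) → Bool
  side = [ const true , const false ]′ ∘ splitAt s

------------------------------------------------------------------------
-- Connectivity and blocks

Linked : Graph n → Fin n → Fin n → Set
Linked G = Star (λ u v → μ G u v ≢ 0)

-- The components of G are the classes of Linked G on V G.

OnlyOneComponent : Graph n → Set
OnlyOneComponent G = Nonempty (V G) × (∀ {u v} → u ∈ V G → v ∈ V G → Linked G u v)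

AtLeastTwoComponents : Graph n → Set
AtLeastTwoComponents G = ∃[ u ] ∃[ v ] u ∈ V G × v ∈ V G × ¬ Linked G u v

Connected : Graph n → Set
Connected = OnlyOneComponent

SeparatingVertex : Graph n → Fin n → Set
SeparatingVertex G v = v ∈ V G × AtLeastTwoComponents (G [ V G - v ])

Nonseparable : Graph n → Set
Nonseparable G = Connected G × ¬ (∃[ v ] SeparatingVertex G v)

record IsBlockOf (B G : Graph n) : Set where
  field
    subgraph     : B ⊑ G
    nonseparable : Nonseparable B
    maximal      : ∀ B′ → B′ ⊑ G → Nonseparable B′ → B ⊑ B′ → B′ ⊑ B

IsBlock : Graph n → Set
IsBlock G = IsBlockOf G G × (∀ B → IsBlockOf B G → B ≈ G)

------------------------------------------------------------------------
-- Covers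

Disjoint : Subset n → Subset n → Set
Disjoint A B = Empty (A ∩ B)

-- An edge with a direction of traversal: (x , y , e) is the e-th of the
-- edges joining x and y.

Edge : Graph N → Set
Edge {N} H = Σ[ x ∈ Fin N ] Σ[ y ∈ Fin N ] Fin (μ H x y)

source target : {H : Graph N} → Edge H → Fin N
source (x , _ , _) = x
target (_ , y , _) = y

-- For sets of edges directed from a set A to a set B disjoint from A, two
-- edges have a common endpoint iff they have a common source or target.

IsMatching : (H : Graph N) → (Edge H → Bool) → Set
IsMatching H M = ∀ e e′ → T (M e) → T (M e′) →
  source {H = H} e ≡ source {H = H} e′ ⊎ target {H = H} e ≡ target {H = H} e′ → e ≡ e′

record EdgesAreUnionOfMatchings (H : Graph N) (A B : Subset N) (k : ℕ) : Set where
  field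
    matching   : Fin k → Edge H → Bool
    isMatching : ∀ i → IsMatching H (matching i)
    union      : ∀ e → (source {H = H} e ∈ A × target {H = H} e ∈ B) ⇔ (∃[ i ] T (matching i e))

-- Only the values of X on V G are relevant.

record IsCover (G : Graph n) (X : Fin n → Subset N) (H : Graph N) : Set where
  field
    disjoint    : ∀ {u v} → u ∈ V G → v ∈ V G → u ≢ v → Disjoint (X u) (X v)
    union       : ∀ x → x ∈ V H ⇔ (∃[ v ] v ∈ V G × x ∈ X v)
    independent : ∀ {v x y} → v ∈ V G → x ∈ X v → y ∈ X v → μ H x y ≡ 0
    matchings   : ∀ {u v} → u ∈ V G → v ∈ V G → u ≢ v →
                  EdgesAreUnionOfMatchings H (X u) (X v) (μ G u v)

-- (X , H)/U is (X ↾ U , H [ U ]), a cover of the subgraph of G induced by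
-- the v with X v ∩ U nonempty.  When it is required below to be an inflation
-- of a cover of G, the field parts makes this subgraph all of G.

infixl 9 _↾_

_↾_ : (Fin n → Subset N) → Subset N → Fin n → Subset N
(X ↾ U) v = X v ∩ U

⋃[_] : Subset n → (Fin n → Subset N) → Subset N
⋃[ W ] X = tabulate λ x → does (any? λ v → v ∈? W ×-dec x ∈? X v)

-- A configuration is given by G, X, H and f with IsCover G X H.  Here f is
-- a function on the ambient set of H, of which only the values on V H are
-- relevant.

record IsUniform (G : Graph n) (X : Fin n → Subset N) (H : Graph N) : Set where
  field
    isCover : IsCover G X H
    size    : ∃[ r ] 1 ≤ r × (∀ {v} → v ∈ V G → ∣ X v ∣ ≡ r)

------------------------------------------------------------------------
-- Special covers

record IsGCover (G : Graph n) (X : Fin n → Subset N) (H : Graph N) : Set where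
  field
    isCover    : IsCover G X H
    x          : Fin n → Fin N
    singletons : ∀ {v} → v ∈ V G → X v ≡ ⁅ x v ⁆
    edges      : ∀ {u v} → u ∈ V G → v ∈ V G → u ≢ v → μ H (x u) (x v) ≡ μ G u v

-- A double cover of a graph G that is t C_k, where v lists its vertices in
-- cyclic order.

record IsDoubleCover (G : Graph n) {k : ℕ} (t : ℕ) (v : Fin k → Fin n)
                     (X : Fin n → Subset N) (H : Graph N) : Set where
  field
    isCover   : IsCover G X H
    x         : Fin (k + k) → Fin N
    injective : ∀ {i j} → x i ≡ x j → i ≡ j
    pairs     : ∀ i → X (v i) ≡ ⁅ x (i ↑ˡ k) ⁆ ∪ ⁅ x (k ↑ʳ i) ⁆
    edges     : ∀ i j → CyclicNeighbours (k + k) i j → μ H (x i) (x j) ≡ t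
    nonedges  : ∀ i j → ¬ CyclicNeighbours (k + k) i j → μ H (x i) (x j) ≡ 0

-- (X̃ , H̃) is the s-inflation of the cover (X , H) of G.  The set of new
-- vertices replacing x is copies x.

record IsInflation (G : Graph n) (s : ℕ) (X : Fin n → Subset N) (H : Graph N)
                   (X̃ : Fin n → Subset N₁) (H̃ : Graph N₁) : Set where
  field
    isCover     : IsCover G X H
    positive    : 1 ≤ s
    divides     : ∀ x y → s ∣ μ H x y
    copies      : Fin N → Subset N₁
    size        : ∀ {x} → x ∈ V H → ∣ copies x ∣ ≡ s
    disjoint    : ∀ {x y} → x ∈ V H → y ∈ V H → x ≢ y → Disjoint (copies x) (copies y)
    vertices    : ∀ a → a ∈ V H̃ ⇔ (∃[ x ] x ∈ V H × a ∈ copies x)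
    parts       : ∀ {v} → v ∈ V G → ∀ a → a ∈ X̃ v ⇔ (∃[ x ] x ∈ X v × a ∈ copies x)
    independent : ∀ {x a b} → x ∈ V H → a ∈ copies x → b ∈ copies x → μ H̃ a b ≡ 0
    edges       : ∀ {x y a b} → x ∈ V H → y ∈ V H → x ≢ y → a ∈ copies x → b ∈ copies y →
                  μ H̃ a b ≡ _∣_.quotient (divides x y)

IsInflatedGCover : (G : Graph n) → (Fin n → Subset N₁) → Graph N₁ → Set
IsInflatedGCover {n} G X̃ H̃ =
  ∃[ N ] Σ[ X ∈ (Fin n → Subset N) ] Σ[ H ∈ Graph N ] ∃[ s ]
    IsGCover G X H × IsInflation G s X H X̃ H̃

IsInflatedDoubleCover : (G : Graph n) {k : ℕ} (t : ℕ) (v : Fin k → Fin n) →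
                        (Fin n → Subset N₁) → Graph N₁ → Set
IsInflatedDoubleCover {n} G t v X̃ H̃ =
  ∃[ N ] Σ[ X ∈ (Fin n → Subset N) ] Σ[ H ∈ Graph N ] ∃[ s ]
    IsDoubleCover G t v X H × IsInflation G s X H X̃ H̃

------------------------------------------------------------------------
-- M-, K- and C-configurations

-- The prescription f(x) = d / |X_v(U)| is written f x * ∣ (X ↾ U) v ∣ ≡ d,
-- the set (X ↾ U) v being nonempty as it contains x.

record IsMConfiguration (G : Graph n) (X : Fin n → Subset N) (H : Graph N) (f : Fin N → ℕ) : Set where
  field
    isUniform : IsUniform G X H
    isBlock   : IsBlock G
    U         : Subset N
    U⊆VH      : U ⊆ V H
    inflated  : IsInflatedGCover G (X ↾ U) (H [ U ])
    f-inside  : ∀ {v x} → v ∈ V G → x ∈ X v → x ∈ U → f x * ∣ (X ↾ U) v ∣ ≡ degree G v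
    f-outside : ∀ {v x} → v ∈ V G → x ∈ X v → x ∉ U → f x ≡ 0

record IsKConfiguration (G : Graph n) (X : Fin n → Subset N) (H : Graph N) (f : Fin N → ℕ) : Set where
  field
    isUniform : IsUniform G X H
    t k       : ℕ
    1≤t       : 1 ≤ t
    1≤k       : 1 ≤ k
    G≅tK      : G ≅ t · complete k
    p         : ℕ
    1≤p       : 1 ≤ p
    ns        : Fin p → ℕ
    1≤ns      : ∀ i → 1 ≤ ns i
    sum-ns    : suc (sum ns) ≡ k
    U         : Fin p → Subset N
    U⊆VH      : ∀ i → U i ⊆ V H
    disjoint  : ∀ {i j} → i ≢ j → Disjoint (U i) (U j)
    inflated  : ∀ i → IsInflatedGCover G (X ↾ U i) (H [ U i ])
    f-inside  : ∀ {v x} → v ∈ V G → x ∈ X v → ∀ i → x ∈ U i → f x * ∣ (X ↾ U i) v ∣ ≡ t * ns i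
    f-outside : ∀ {v x} → v ∈ V G → x ∈ X v → (∀ i → x ∉ U i) → f x ≡ 0

record IsOddCConfiguration (G : Graph n) (X : Fin n → Subset N) (H : Graph N) (f : Fin N → ℕ) : Set where
  field
    isUniform : IsUniform G X H
    t k       : ℕ
    1≤t       : 1 ≤ t
    3≤k       : 3 ≤ k
    odd       : 2 ∤ k
    G≅tC      : G ≅ t · cycle k 3≤k
    U         : Fin 2 → Subset N
    U⊆VH      : ∀ i → U i ⊆ V H
    disjoint  : ∀ {i j} → i ≢ j → Disjoint (U i) (U j)
    inflated  : ∀ i → IsInflatedGCover G (X ↾ U i) (H [ U i ])
    f-inside  : ∀ {v x} → v ∈ V G → x ∈ X v → ∀ i → x ∈ U i → f x * ∣ (X ↾ U i) v ∣ ≡ t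
    f-outside : ∀ {v x} → v ∈ V G → x ∈ X v → (∀ i → x ∉ U i) → f x ≡ 0

record IsEvenCConfiguration (G : Graph n) (X : Fin n → Subset N) (H : Graph N) (f : Fin N → ℕ) : Set where
  field
    isUniform : IsUniform G X H
    t k       : ℕ
    1≤t       : 1 ≤ t
    4≤k       : 4 ≤ k
    even      : 2 ∣ k
    G≅tC      : G ≅ t · cycle k (<⇒≤ 4≤k)

  v : Fin k → Fin n
  v i = proj₁ (Inverse.from (_≅_.vertices G≅tC) (i , ∈⊤))

  field
    U         : Subset N
    U⊆VH      : U ⊆ V H
    inflated  : IsInflatedDoubleCover G t v (X ↾ U) (H [ U ])
    f-inside  : ∀ {w x} → w ∈ V G → x ∈ X w → x ∈ U → f x * ∣ (X ↾ U) w ∣ ≡ 2 * t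
    f-outside : ∀ {w x} → w ∈ V G → x ∈ X w → x ∉ U → f x ≡ 0

IsCConfiguration : Graph n → (Fin n → Subset N) → Graph N → (Fin N → ℕ) → Set
IsCConfiguration G X H f = IsOddCConfiguration G X H f ⊎ IsEvenCConfiguration G X H f

------------------------------------------------------------------------
-- Identifying vertices of two disjoint graphs

-- G arises from disjoint copies of G₁ and G₂ by identifying x with y
-- whenever R x y.  Being in different types, G₁ and G₂ are disjoint; ι₁ and
-- ι₂ send vertices to their images in G.

record IsIdentification (G₁ : Graph n₁) (G₂ : Graph n₂) (R : Fin n₁ → Fin n₂ → Set)
                        (G : Graph n) (ι₁ : Fin n₁ → Fin n) (ι₂ : Fin n₂ → Fin n) : Set where
  field
    vertices   : ∀ z → z ∈ V G ⇔
                 ((∃[ x ] x ∈ V G₁ × ι₁ x ≡ z) ⊎ (∃[ y ] y ∈ V G₂ × ι₂ y ≡ z))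
    injective₁ : ∀ {x x′} → x ∈ V G₁ → x′ ∈ V G₁ → ι₁ x ≡ ι₁ x′ → x ≡ x′
    injective₂ : ∀ {y y′} → y ∈ V G₂ → y′ ∈ V G₂ → ι₂ y ≡ ι₂ y′ → y ≡ y′
    identified : ∀ {x y} → x ∈ V G₁ → y ∈ V G₂ → ι₁ x ≡ ι₂ y ⇔ R x y
    edges₁     : ∀ {x x′} → x ∈ V G₁ → x′ ∈ V G₁ → ¬ ((∃[ y ] R x y) × (∃[ y ] R x′ y)) →
                 μ G (ι₁ x) (ι₁ x′) ≡ μ G₁ x x′
    edges₂     : ∀ {y y′} → y ∈ V G₂ → y′ ∈ V G₂ → ¬ ((∃[ x ] R x y) × (∃[ x ] R x y′)) →
                 μ G (ι₂ y) (ι₂ y′) ≡ μ G₂ y y′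
    edges₁₂    : ∀ {x x′ y y′} → R x y → R x′ y′ →
                 μ G (ι₁ x) (ι₁ x′) ≡ μ G₁ x x′ + μ G₂ y y′
    nonedges   : ∀ {x y} → x ∈ V G₁ → y ∈ V G₂ → ¬ (∃[ y′ ] R x y′) → ¬ (∃[ x′ ] R x′ y) →
                 μ G (ι₁ x) (ι₂ y) ≡ 0

record IsBijection (A : Subset n₁) (B : Subset n₂) (π : Fin n₁ → Fin n₂) : Set where
  field
    maps       : ∀ {x} → x ∈ A → π x ∈ B
    injective  : ∀ {x x′} → x ∈ A → x′ ∈ A → π x ≡ π x′ → x ≡ x′
    surjective : ∀ {y} → y ∈ B → ∃[ x ] x ∈ A × π x ≡ y

record IsMerger
  (G¹ : Graph n₁) (X¹ : Fin n₁ → Subset N₁) (H¹ : Graph N₁) (f¹ : Fin N₁ → ℕ)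
  (G² : Graph n₂) (X² : Fin n₂ → Subset N₂) (H² : Graph N₂) (f² : Fin N₂ → ℕ)
  (G : Graph n) (X : Fin n → Subset N) (H : Graph N) (f : Fin N → ℕ) : Set where
  field
    v¹       : Fin n₁
    v²       : Fin n₂
    v¹∈G¹    : v¹ ∈ V G¹
    v²∈G²    : v² ∈ V G²
    ι¹       : Fin n₁ → Fin n
    ι²       : Fin n₂ → Fin n
    graph    : IsIdentification G¹ G² (λ x y → x ≡ v¹ × y ≡ v²) G ι¹ ι²
    π        : Fin N₁ → Fin N₂
    π-bij    : IsBijection (X¹ v¹) (X² v²) π
    κ¹       : Fin N₁ → Fin N
    κ²       : Fin N₂ → Fin N
    cover    : IsIdentification H¹ H² (λ x y → x ∈ X¹ v¹ × π x ≡ y) H κ¹ κ²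
    parts¹   : ∀ {v} → v ∈ V G¹ → ∀ z → z ∈ X (ι¹ v) ⇔ (∃[ x ] x ∈ X¹ v × κ¹ x ≡ z)
    parts²   : ∀ {v} → v ∈ V G² → ∀ z → z ∈ X (ι² v) ⇔ (∃[ y ] y ∈ X² v × κ² y ≡ z)
    f-first  : ∀ {x} → x ∈ V H¹ → x ∉ X¹ v¹ → f (κ¹ x) ≡ f¹ x
    f-second : ∀ {y} → y ∈ V H² → y ∉ X² v² → f (κ² y) ≡ f² y
    f-common : ∀ {x} → x ∈ X¹ v¹ → f (κ¹ x) ≡ f¹ x + f² (π x)

------------------------------------------------------------------------
-- Constructible configurations

data Constructible : ∀ {n N} → Graph n → (Fin n → Subset N) → Graph N → (Fin N → ℕ) → Set where
  mConfiguration : ∀ {n N} {G : Graph n} {X} {H : Graph N} {f} →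
    IsMConfiguration G X H f → Constructible G X H f
  kConfiguration : ∀ {n N} {G : Graph n} {X} {H : Graph N} {f} →
    IsKConfiguration G X H f → Constructible G X H f
  oddCConfiguration : ∀ {n N} {G : Graph n} {X} {H : Graph N} {f} →
    IsOddCConfiguration G X H f → Constructible G X H f
  evenCConfiguration : ∀ {n N} {G : Graph n} {X} {H : Graph N} {f} →
    IsEvenCConfiguration G X H f → Constructible G X H f
  merger : ∀ {n₁ N₁ n₂ N₂ n N}
    {G¹ : Graph n₁} {X¹} {H¹ : Graph N₁} {f¹}
    {G² : Graph n₂} {X²} {H² : Graph N₂} {f²}
    {G : Graph n} {X} {H : Graph N} {f} →
    IsUniform G X H → Constructible G¹ X¹ H¹ f¹ → Constructible G² X² H² f² →
    IsMerger G¹ X¹ H¹ f¹ G² X² H² f² G X H f → Constructible G X H f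

-- A block is the subgraph induced by its vertex set (by maximality), so
-- the family of B-parts is indexed by the vertex sets of the blocks, which
-- are listed without repetition by blocks; the values of part at other
-- sets are irrelevant.

record AreParts (G : Graph n) (X : Fin n → Subset N) (H : Graph N) (f : Fin N → ℕ)
                (part : Subset n → Fin N → ℕ) : Set where
  field
    isMKC    : ∀ {B} → IsBlockOf B G → let Hᴮ = H [ ⋃[ V B ] X ] ; fᴮ = part (V B) in
               IsMConfiguration B X Hᴮ fᴮ ⊎ IsKConfiguration B X Hᴮ fᴮ ⊎ IsCConfiguration B X Hᴮ fᴮ
    blocks   : List (Subset n)
    listed   : ∀ {B} → IsBlockOf B G → V B ∈ₗ blocks
    sound    : ∀ {W} → W ∈ₗ blocks → ∃[ B ] IsBlockOf B G × V B ≡ W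
    unique   : Unique blocks
    total    : ∀ {v x} → v ∈ V G → x ∈ X v →
               f x ≡ sumₗ (List.map (λ W → if does (v ∈? W) then part W x else 0) blocks)

-- A vertex a of X u lies on at most one edge of each of the μ(u,v) matchings between
-- X u and X v.  Hence, if C ⊆ X u and D ⊆ X v are joined completely, with μ(u,v) edges
-- at each vertex, then no other edge of H[X u ∪ X v] meets C ∪ D; if this graph is
-- connected, C = X u and D = X v.  With C and D the traces of an inflated G-cover
-- (X , H)/U, uniformity then forces U to contain every X w.  Two disjoint such U are
-- impossible, which excludes odd C-configurations and leaves K-configurations with
-- p = 1, and these are M-configurations.  In an even C-configuration, such a pair C, D
-- covers only half of U in X u, a contradiction.

module Submission where

open import Defs
open import Data.Bool.Base using (T; true; false; _xor_; if_then_else_)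
open import Data.Fin.Base using (Fin; zero; suc; toℕ; join; splitAt; combine; remQuot; punchIn; _↑ˡ_; _↑ʳ_)
open import Data.Fin.Properties
  using (_≟_; any?; pigeonhole; <⇒≢; combine-remQuot; join-splitAt; splitAt-join;
         toℕ-↑ˡ; toℕ-↑ʳ; toℕ<n; punchInᵢ≢i)
open import Data.Fin.Subset
  using (Subset; inside; outside; _∈_; _∉_; _⊆_; _∩_; _∪_; _-_; ∣_∣; ⊥; Nonempty)
open import Data.Fin.Subset.Properties
  using (_∈?_; ∈⊤; ∉⊥; x∈⁅x⁆; x∈⁅y⁆⇒x≡y; ⊆-antisym; p⊂q⇒∣p∣<∣q∣; p∩q⊆p; p∩q⊆q; x∈p∩q⁺; x∈p∩q⁻; x∈p∪q⁻; x∈p∪q⁺)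
open import Data.Nat.Base using (ℕ; zero; suc; _+_; _*_; _≤_; _<_; z≤n; s≤s⁻¹; >-nonZero)
  renaming (∣_-_∣ to dist)
open import Data.Nat.Divisibility using (_∣_; divides; ∣-refl; ∣⇒≤; >⇒∤)
open import Data.Nat.Properties as ℕ
  using (+-identityʳ; *-zeroʳ; *-identityʳ; *-comm; ≤-antisym; ≤-refl; ≤-reflexive)
open import Data.Product.Base using (Σ-syntax; ∃-syntax; _×_; _,_; proj₁; proj₂; uncurry)
open import Data.Product.Properties.WithK using (,-injectiveʳ)
open import Data.Sum.Base as Sum using (_⊎_; inj₁; inj₂; [_,_]′)
open import Data.Vec.Base using ([]; _∷_; here; there; lookup)
open import Data.Vec.Properties using ([]=⇒lookup; lookup⇒[]=; lookup∘tabulate)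
open import Data.Vec.Properties.WithK using ([]=-irrelevant)
open import Function.Base using (_∘_)
open import Function.Bundles using (_↔_; Inverse; Equivalence; mk↔ₛ′)
open import Relation.Binary.Construct.Closure.ReflexiveTransitive using (fold; map)
open import Relation.Binary.PropositionalEquality
  using (_≡_; _≢_; refl; sym; trans; cong; cong₂; subst; module ≡-Reasoning)
open import Relation.Nullary using (¬_; Dec; yes; no; does; contradiction)
open import Relation.Nullary.Decidable using (_×-dec_; dec-true; dec-false)

open import Algebra.Properties.CommutativeMonoid.Sum ℕ.+-0-commutativeMonoid
  using (sum-remove; ∑-comm; sum-cong-≗; sum-replicate-zero)

private
  variable
    n N k m q : ℕ

∈-unique : {p : Subset n} {a b : ∃[ x ] x ∈ p} → proj₁ a ≡ proj₁ b → a ≡ b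
∈-unique {a = _ , x∈} {b = _ , y∈} refl = cong (_ ,_) ([]=-irrelevant x∈ y∈)

elements : (p : Subset n) → (∃[ x ] x ∈ p) ↔ Fin ∣ p ∣
elements []            = mk↔ₛ′ (λ ()) (λ ()) (λ ()) (λ ())
elements (inside ∷ p)  = mk↔ₛ′
  (λ { (zero , here) → zero ; (suc x , there x∈p) → suc (to (x , x∈p)) })
  (λ { zero → zero , here ; (suc i) → suc (proj₁ (from i)) , there (proj₂ (from i)) })
  (λ { zero → refl ; (suc i) → cong suc (strictlyInverseˡ i) })
  (λ { (zero , here) → refl ; (suc x , there x∈p) → ∈-unique (cong (suc ∘ proj₁) (strictlyInverseʳ (x , x∈p))) })
  where open Inverse (elements p)
elements (outside ∷ p) = mk↔ₛ′
  (λ { (suc x , there x∈p) → to (x , x∈p) })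
  (λ i → suc (proj₁ (from i)) , there (proj₂ (from i)))
  strictlyInverseˡ
  (λ { (suc x , there x∈p) → ∈-unique (cong (suc ∘ proj₁) (strictlyInverseʳ (x , x∈p))) })
  where open Inverse (elements p)

⊆-∣∣≡⇒⊇ : {p q : Subset n} → p ⊆ q → ∣ p ∣ ≡ ∣ q ∣ → q ⊆ p
⊆-∣∣≡⇒⊇ {p = p} p⊆q ∣p∣≡∣q∣ {x} x∈q with x ∈? p
... | yes x∈p = x∈p
... | no  x∉p = contradiction ∣p∣≡∣q∣ (ℕ.<⇒≢ (p⊂q⇒∣p∣<∣q∣ (p⊆q , x , x∈q , x∉p)))

∣∣≥1⇒nonempty : (p : Subset n) → 1 ≤ ∣ p ∣ → Nonempty p
∣∣≥1⇒nonempty p 1≤∣p∣ with ∣ p ∣ | Inverse.from (elements p)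
... | suc _ | from = from zero

sum-single : (g : Fin n → ℕ) (i : Fin n) → (∀ j → j ≢ i → g j ≡ 0) → sum g ≡ g i
sum-single {suc n} g i zeros = begin
  sum g                           ≡⟨ sum-remove {i = i} g ⟩
  g i + sum (λ j → g (punchIn i j)) ≡⟨ cong (g i +_) (sum-cong-≗ (λ j → zeros _ (punchInᵢ≢i i j))) ⟩
  g i + sum {n} (λ _ → 0)         ≡⟨ cong (g i +_) (sum-replicate-zero n) ⟩
  g i + 0                         ≡⟨ +-identityʳ (g i) ⟩
  g i                             ∎
  where open ≡-Reasoning

-- Both sides are the sum of g w over all pairs (w , i) with φ i ≡ w.
sum-reindex : (g : Fin n → ℕ) (φ : Fin k → Fin n) → (∀ {i j} → φ i ≡ φ j → i ≡ j) →
              (∀ w → g w ≢ 0 → ∃[ i ] φ i ≡ w) → sum g ≡ sum (g ∘ φ)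
sum-reindex {n} {k} g φ inj covers = begin
  sum g                       ≡⟨ sum-cong-≗ (λ w → sym (row w)) ⟩
  sum (λ w → sum (pairs w))   ≡⟨ ∑-comm pairs ⟩
  sum (λ i → sum (λ w → pairs w i)) ≡⟨ sum-cong-≗ column ⟩
  sum (g ∘ φ)                 ∎
  where
  open ≡-Reasoning
  pairs : Fin n → Fin k → ℕ
  pairs w i = if does (φ i ≟ w) then g w else 0
  on : ∀ {w i} → φ i ≡ w → pairs w i ≡ g w
  on {w} {i} eq rewrite dec-true (φ i ≟ w) eq = refl
  off : ∀ {w i} → φ i ≢ w → pairs w i ≡ 0
  off {w} {i} neq rewrite dec-false (φ i ≟ w) neq = refl
  row : ∀ w → sum (pairs w) ≡ g w
  row w with g w ℕ.≟ 0
  ... | no gw≢0 with i , φi≡w ← covers w gw≢0 =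
    trans (sum-single (pairs w) i (λ j j≢i → off (λ φj≡w → j≢i (inj (trans φj≡w (sym φi≡w)))))) (on φi≡w)
  ... | yes gw≡0 = trans (trans (sum-cong-≗ vanish) (sum-replicate-zero k)) (sym gw≡0)
    where
    vanish : ∀ i → pairs w i ≡ 0
    vanish i with φ i ≟ w
    ... | yes _ = gw≡0
    ... | no  _ = refl
  column : ∀ i → sum (λ w → pairs w i) ≡ g (φ i)
  column i = trans (sum-single (λ w → pairs w i) (φ i) (λ w w≢ → off (w≢ ∘ sym))) (on refl)

sum-const : ∀ n t → sum {n} (λ _ → t) ≡ t * n
sum-const zero    t = sym (*-zeroʳ t)
sum-const (suc n) t = trans (cong (t +_) (sum-const n t)) (sym (ℕ.*-suc t n))

induced-∈ : (H : Graph N) {W : Subset N} {x y : Fin N} → x ∈ W → y ∈ W → μ (H [ W ]) x y ≡ μ H x y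
induced-∈ H x∈W y∈W rewrite []=⇒lookup x∈W | []=⇒lookup y∈W = refl

induced-support : (H : Graph N) {W : Subset N} {x y : Fin N} → μ (H [ W ]) x y ≢ 0 → x ∈ W × y ∈ W
induced-support H {W} {x} {y} μ≢0 =
  p∩q⊆q (V H) W (support (H [ W ]) μ≢0) ,
  p∩q⊆q (V H) W (support (H [ W ]) (μ≢0 ∘ trans (symmetric (H [ W ]) x y)))

subst-injective : (eq : m ≡ k) {i j : Fin m} → subst Fin eq i ≡ subst Fin eq j → i ≡ j
subst-injective refl eq = eq

matchings-bound : {H : Graph N} {A B : Subset N} → EdgesAreUnionOfMatchings H A B k →
  (a : Fin N) → a ∈ A → (edge : Fin m → Σ[ b ∈ Fin N ] Fin (μ H a b)) →
  (∀ {i j} → edge i ≡ edge j → i ≡ j) → (∀ i → proj₁ (edge i) ∈ B) → m ≤ k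
matchings-bound {H = H} matchings a a∈A edge injective targets = ℕ.≮⇒≥ λ k<m →
  let i , j , i<j , same = pigeonhole k<m (proj₁ ∘ coloured)
      e≡e′ = isMatching _ (a , edge i) (a , edge j) (proj₂ (coloured i))
               (subst (λ c → T (matching c (a , edge j))) (sym same) (proj₂ (coloured j))) (inj₁ refl)
  in <⇒≢ i<j (injective (,-injectiveʳ e≡e′))
  where
  open EdgesAreUnionOfMatchings matchings
  coloured : ∀ i → ∃[ c ] T (matching c (a , edge i))
  coloured i = Equivalence.to (union (a , edge i)) (a∈A , targets i)

-- The edges from a to D already use every matching once.
saturated : {H : Graph N} {A B D : Subset N} {a b : Fin N} →
  EdgesAreUnionOfMatchings H A B (∣ D ∣ * q) → a ∈ A → D ⊆ B →
  (∀ {d} → d ∈ D → μ H a d ≡ q) → b ∈ B → μ H a b ≢ 0 → b ∈ D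
saturated {N} {q} {H} {A} {B} {D} {a} {b} matchings a∈A D⊆B full b∈B μ≢0 with b ∈? D
... | yes b∈D = b∈D
... | no  b∉D = contradiction (matchings-bound matchings a a∈A edge edge-injective edge-target) (ℕ.<⇒≱ ≤-refl)
  where
  module E = Inverse (elements D)
  EdgeFrom = Σ[ b ∈ Fin N ] Fin (μ H a b)
  edgeToD : Fin ∣ D ∣ × Fin q → EdgeFrom
  edgeToD (x , c) = proj₁ (E.from x) , subst Fin (sym (full (proj₂ (E.from x)))) c
  edgeToD-injective : ∀ p p′ → edgeToD p ≡ edgeToD p′ → p ≡ p′
  edgeToD-injective (x , c) (y , c′) eq
    with refl ← trans (sym (E.strictlyInverseˡ x))
      (trans (cong E.to (∈-unique (cong proj₁ eq))) (E.strictlyInverseˡ y)) =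
    cong (x ,_) (subst-injective (sym (full (proj₂ (E.from x)))) (,-injectiveʳ eq))
  edge : Fin (suc (∣ D ∣ * q)) → EdgeFrom
  edge zero    = b , subst Fin (ℕ.suc-pred _ {{>-nonZero (ℕ.n≢0⇒n>0 μ≢0)}}) zero
  edge (suc i) = edgeToD (remQuot {∣ D ∣} q i)
  edge-injective : ∀ {i j} → edge i ≡ edge j → i ≡ j
  edge-injective {zero}  {zero}  _  = refl
  edge-injective {zero}  {suc j} eq = contradiction (subst (_∈ D) (sym (cong proj₁ eq)) (proj₂ (E.from _))) b∉D
  edge-injective {suc i} {zero}  eq = contradiction (subst (_∈ D) (cong proj₁ eq) (proj₂ (E.from _))) b∉D
  edge-injective {suc i} {suc j} eq = cong suc
    (trans (sym (combine-remQuot {∣ D ∣} q i))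
    (trans (cong (uncurry combine) (edgeToD-injective (remQuot {∣ D ∣} q i) (remQuot {∣ D ∣} q j) eq))
           (combine-remQuot {∣ D ∣} q j)))
  edge-target : ∀ i → proj₁ (edge i) ∈ B
  edge-target zero    = b∈B
  edge-target (suc i) = D⊆B (proj₂ (E.from (proj₁ (remQuot {∣ D ∣} q i))))

module _ {G : Graph n} {X : Fin n → Subset N} {H : Graph N} (cover : IsCover G X H) where
  open IsCover cover

  parts⊆ : ∀ {v} → v ∈ V G → X v ⊆ V H
  parts⊆ v∈ x∈ = Equivalence.from (union _) (_ , v∈ , x∈)

  saturated-pair : ∀ {u v} → u ∈ V G → v ∈ V G → u ≢ v → OnlyOneComponent (H [ X u ∪ X v ]) →
    ∀ {C D} → C ⊆ X u → D ⊆ X v → Nonempty C → (∀ {a b} → a ∈ C → b ∈ D → μ H a b ≡ q) →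
    ∣ C ∣ * q ≡ μ G u v → ∣ D ∣ * q ≡ μ G u v → X u ⊆ C × X v ⊆ D
  saturated-pair {q} {u} {v} u∈ v∈ u≢v (_ , linked) {C} {D} C⊆ D⊆ (c , c∈C) full ∣C∣q ∣D∣q =
    (λ a∈ → [ (λ a∈C → a∈C) , (λ a∈D → contradiction (x∈p∩q⁺ (a∈ , D⊆ a∈D)) (apart ∘ (_ ,_))) ]′
      (reach (x∈p∪q⁺ (inj₁ a∈)))) ,
    (λ b∈ → [ (λ b∈C → contradiction (x∈p∩q⁺ (C⊆ b∈C , b∈)) (apart ∘ (_ ,_))) , (λ b∈D → b∈D) ]′
      (reach (x∈p∪q⁺ (inj₂ b∈))))
    where
    apart = disjoint u∈ v∈ u≢v
    inU : ∀ {x} → x ∈ X u ∪ X v → x ∈ V (H [ X u ∪ X v ])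
    inU x∈ = x∈p∩q⁺ ([ parts⊆ u∈ , parts⊆ v∈ ]′ (x∈p∪q⁻ (X u) (X v) x∈) , x∈)
    step : ∀ {x y} → μ (H [ X u ∪ X v ]) x y ≢ 0 → x ∈ C ⊎ x ∈ D → y ∈ C ⊎ y ∈ D
    step {x} {y} e x∈ with induced-support H e
    ... | x∈∪ , y∈∪ with x∈ | x∈p∪q⁻ (X u) (X v) y∈∪ | e ∘ trans (induced-∈ H x∈∪ y∈∪)
    ... | inj₁ x∈C | inj₁ y∈u | e′ = contradiction (independent u∈ (C⊆ x∈C) y∈u) e′
    ... | inj₁ x∈C | inj₂ y∈v | e′ = inj₂ (saturated {q = q} {H = H}
      (subst (EdgesAreUnionOfMatchings H _ _) (sym ∣D∣q) (matchings u∈ v∈ u≢v)) (C⊆ x∈C) D⊆ (full x∈C) y∈v e′)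
    ... | inj₂ x∈D | inj₂ y∈v | e′ = contradiction (independent v∈ (D⊆ x∈D) y∈v) e′
    ... | inj₂ x∈D | inj₁ y∈u | e′ = inj₁ (saturated {q = q} {H = H}
      (subst (EdgesAreUnionOfMatchings H _ _) (sym (trans ∣C∣q (symmetric G u v))) (matchings v∈ u∈ (u≢v ∘ sym)))
      (D⊆ x∈D) C⊆ (λ d∈C → trans (symmetric H _ _) (full d∈C x∈D)) y∈u e′)
    reach : ∀ {x} → x ∈ X u ∪ X v → x ∈ C ⊎ x ∈ D
    reach {x} x∈ = fold (λ x y → x ∈ C ⊎ x ∈ D → y ∈ C ⊎ y ∈ D) (λ e k → k ∘ step e) (λ p → p)
      (linked (inU (x∈p∪q⁺ (inj₁ (C⊆ c∈C)))) (inU x∈)) (inj₁ c∈C)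

inflatedGCover-complete : {G : Graph n} {Y : Fin n → Subset N} {K : Graph N} → IsInflatedGCover G Y K →
  ∃[ s ] 1 ≤ s × (∀ {v} → v ∈ V G → ∣ Y v ∣ ≡ s) ×
  (∀ {u v} → u ∈ V G → v ∈ V G → u ≢ v →
    ∃[ q ] s * q ≡ μ G u v × (∀ {a b} → a ∈ Y u → b ∈ Y v → μ K a b ≡ q))
inflatedGCover-complete {n} {G = G} {Y} {K} (_ , X , H , s , gcover , inflation) =
  s , I.positive , (λ v∈ → trans (cong ∣_∣ (Y≡ v∈)) (I.size (x∈ v∈))) , λ u∈ v∈ u≢v →
    _∣_.quotient (I.divides (x _) (x _)) ,
    trans (*-comm s _) (trans (sym (_∣_.equality (I.divides (x _) (x _)))) (edges u∈ v∈ u≢v)) ,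
    λ a∈ b∈ → I.edges (x∈ u∈) (x∈ v∈) (x≢ u∈ v∈ u≢v) (subst (_ ∈_) (Y≡ u∈) a∈) (subst (_ ∈_) (Y≡ v∈) b∈)
  where
  open IsGCover gcover
  module I = IsInflation inflation
  x∈X : ∀ {v} → v ∈ V G → x v ∈ X v
  x∈X v∈ = subst (x _ ∈_) (sym (singletons v∈)) (x∈⁅x⁆ (x _))
  x∈ : ∀ {v} → v ∈ V G → x v ∈ V H
  x∈ v∈ = parts⊆ isCover v∈ (x∈X v∈)
  x≢ : ∀ {u v} → u ∈ V G → v ∈ V G → u ≢ v → x u ≢ x v
  x≢ u∈ v∈ u≢v eq = IsCover.disjoint isCover u∈ v∈ u≢v (_ , x∈p∩q⁺ (x∈X u∈ , subst (_∈ X _) (sym eq) (x∈X v∈)))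
  Y≡ : ∀ {v} → v ∈ V G → Y v ≡ I.copies (x v)
  Y≡ {v} v∈ = ⊆-antisym
    (λ {a} a∈ → let y , y∈ , a∈y = Equivalence.to (I.parts v∈ a) a∈ in
      subst (λ z → a ∈ I.copies z) (x∈⁅y⁆⇒x≡y (x v) (subst (y ∈_) (singletons v∈) y∈)) a∈y)
    (λ {a} a∈ → Equivalence.from (I.parts v∈ a) (x v , x∈X v∈ , a∈))

module _ {G : Graph n} {X : Fin n → Subset N} {H : Graph N} (uniform : IsUniform G X H) where
  open IsUniform uniform

  private
    sub : ∀ U v → (X ↾ U) v ⊆ X v
    sub U v = p∩q⊆p (X v) U

  inflated-everything : ∀ {U u v} → IsInflatedGCover G (X ↾ U) (H [ U ]) →
    u ∈ V G → v ∈ V G → u ≢ v → OnlyOneComponent (H [ X u ∪ X v ]) →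
    ∀ {w} → w ∈ V G → X w ⊆ U
  inflated-everything {U} {u} {v} inflated u∈ v∈ u≢v one {w} w∈ x∈ = p∩q⊆q (X w) U (everything x∈)
    where
    density = inflatedGCover-complete inflated
    s = proj₁ density
    ∣XU∣≡s = proj₁ (proj₂ (proj₂ density))
    all-u : X u ⊆ (X ↾ U) u
    all-u with q , sq , full ← proj₂ (proj₂ (proj₂ density)) u∈ v∈ u≢v =
      proj₁ (saturated-pair isCover u∈ v∈ u≢v one (sub U u) (sub U v)
        (∣∣≥1⇒nonempty _ (subst (1 ≤_) (sym (∣XU∣≡s u∈)) (proj₁ (proj₂ density))))
        (λ a∈ b∈ → trans (sym (induced-∈ H (p∩q⊆q (X u) U a∈) (p∩q⊆q (X v) U b∈))) (full a∈ b∈))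
        (trans (cong (_* q) (∣XU∣≡s u∈)) sq) (trans (cong (_* q) (∣XU∣≡s v∈)) sq))
    r≡s : proj₁ size ≡ s
    r≡s = trans (sym (proj₂ (proj₂ size) u∈)) (trans (cong ∣_∣ (⊆-antisym all-u (sub U u))) (∣XU∣≡s u∈))
    everything : X w ⊆ (X ↾ U) w
    everything = ⊆-∣∣≡⇒⊇ (sub U w) (trans (∣XU∣≡s w∈) (trans (sym r≡s) (sym (proj₂ (proj₂ size) w∈))))

degree-complete : {G : Graph n} {t m : ℕ} → G ≅ t · complete (suc m) → ∀ {v} → v ∈ V G → degree G v ≡ t * m
degree-complete {n} {G} {t} {m} iso {v} v∈ = begin
  degree G v                                  ≡⟨ sum-reindex (μ G v) φ φ-injective covers ⟩
  sum (μ G v ∘ φ)                             ≡⟨ sum-cong-≗ μφ ⟩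
  sum row                                     ≡⟨ sum-remove {i = i} row ⟩
  row i + sum (λ j → row (punchIn i j))       ≡⟨ cong₂ _+_ row-i (sum-cong-≗ row-rest) ⟩
  sum {m} (λ _ → t)                           ≡⟨ sum-const m t ⟩
  t * m                                       ∎
  where
  open ≡-Reasoning
  open _≅_ iso
  open Inverse vertices
  i = proj₁ (to (v , v∈))
  φ : Fin (suc m) → Fin n
  φ j = proj₁ (from (j , ∈⊤))
  φ-injective : ∀ {j k} → φ j ≡ φ k → j ≡ k
  φ-injective {j} {k} eq = cong proj₁
    (trans (sym (strictlyInverseˡ (j , ∈⊤))) (trans (cong to (∈-unique {p = V G} eq)) (strictlyInverseˡ (k , ∈⊤))))
  covers : ∀ w → μ G v w ≢ 0 → ∃[ j ] φ j ≡ w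
  covers w μ≢0 = proj₁ (to w′) ,
    cong proj₁ (trans (cong from (∈-unique {a = proj₁ (to w′) , ∈⊤} {b = to w′} refl)) (strictlyInverseʳ w′))
    where
    w′ : Vertex G
    w′ = w , support G (μ≢0 ∘ trans (symmetric G v w))
  row : Fin (suc m) → ℕ
  row = μ (t · complete (suc m)) i
  μφ : ∀ j → μ G v (φ j) ≡ row j
  μφ j = trans (sym (preserves (v , v∈) (from (j , ∈⊤)))) (cong (row ∘ proj₁) (strictlyInverseˡ (j , ∈⊤)))
  row-i : row i ≡ 0
  row-i = loopless (t · complete (suc m)) i
  row-rest : ∀ j → row (punchIn i j) ≡ t
  row-rest j rewrite dec-false (i ≟ punchIn i j) (punchInᵢ≢i i j ∘ sym) = *-identityʳ t

⊑-refl : (B : Graph n) → B ⊑ B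
⊑-refl B = (λ x∈ → x∈) , λ _ _ → ≤-refl

nonseparable⇒isBlock : {B : Graph n} → Nonseparable B → IsBlock B
nonseparable⇒isBlock {B = B} nonsep =
  record { subgraph = ⊑-refl B ; nonseparable = nonsep ; maximal = λ _ B′⊑B _ _ → B′⊑B } ,
  λ B′ isB′ → let open IsBlockOf isB′ in subgraph , maximal B (⊑-refl B) nonsep subgraph

block-induced : {B G : Graph n} → IsBlockOf B G → ∀ {u v} → u ∈ V B → v ∈ V B → μ B u v ≡ μ G u v
block-induced {B = B} {G} isB {u} {v} u∈ v∈ =
  ≤-antisym (proj₂ subgraph u v)
    (subst (_≤ μ B u v) (induced-∈ G u∈ v∈) (proj₂ (maximal (G [ V B ]) GB⊑G (connected , nonsep) B⊑GB) u v))
  where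
  open IsBlockOf isB
  GB⊑G : G [ V B ] ⊑ G
  GB⊑G = p∩q⊆p (V G) (V B) , μ≤
    where
    μ≤ : ∀ x y → μ (G [ V B ]) x y ≤ μ G x y
    μ≤ x y with lookup (V B) x | lookup (V B) y
    ... | true  | true  = ≤-refl
    ... | true  | false = z≤n
    ... | false | _     = z≤n
  μB≤ : ∀ x y → μ B x y ≤ μ (G [ V B ]) x y
  μB≤ x y with μ B x y ℕ.≟ 0
  ... | yes μ≡0 = subst (_≤ μ (G [ V B ]) x y) (sym μ≡0) z≤n
  ... | no  μ≢0 = subst (μ B x y ≤_)
    (sym (induced-∈ G (support B μ≢0) (support B (μ≢0 ∘ trans (symmetric B x y))))) (proj₂ subgraph x y)
  B⊑GB : B ⊑ G [ V B ]
  B⊑GB = (λ x∈ → x∈p∩q⁺ (proj₁ subgraph x∈ , x∈)) , μB≤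
  back : ∀ {x} → x ∈ V (G [ V B ]) → x ∈ V B
  back = p∩q⊆q (V G) (V B)
  grow : ∀ {x y} → μ B x y ≢ 0 → μ (G [ V B ]) x y ≢ 0
  grow {x} {y} μ≢0 eq = μ≢0 (ℕ.n≤0⇒n≡0 (subst (μ B x y ≤_) eq (μB≤ x y)))
  connected : Connected (G [ V B ])
  connected with (x , x∈) , linked ← proj₁ nonseparable =
    (x , proj₁ B⊑GB x∈) , λ x∈ y∈ → map grow (linked (back x∈) (back y∈))
  GB = V (G [ V B ])
  V≡ : GB ≡ V B
  V≡ = ⊆-antisym back (proj₁ B⊑GB)
  nonsep : ¬ (∃[ w ] SeparatingVertex (G [ V B ]) w)
  nonsep (w , w∈ , x , y , x∈ , y∈ , unlinked) = proj₂ nonseparable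
    (w , back w∈ , x , y , shrink x∈ , shrink y∈ , unlinked ∘ map grow-minus)
    where
    shrink : ∀ {x} → x ∈ GB ∩ (GB - w) → x ∈ V B ∩ (V B - w)
    shrink {x} = subst (λ W → x ∈ W ∩ (W - w)) V≡
    grow-minus : ∀ {x y} → μ (B [ V B - w ]) x y ≢ 0 → μ ((G [ V B ]) [ GB - w ]) x y ≢ 0
    grow-minus {x} {y} μ≢0 with x∈ , y∈ ← induced-support B μ≢0 =
      grow (μ≢0 ∘ trans (induced-∈ B x∈ y∈)) ∘ trans (sym (induced-∈ (G [ V B ]) (widen x∈) (widen y∈)))
      where
      widen : ∀ {z} → z ∈ V B - w → z ∈ GB - w
      widen {z} = subst (λ W → z ∈ W - w) (sym V≡)

μ-completeBipartite : ∀ s (a b : Fin s ⊎ Fin s) →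
  μ (completeBipartite s) (join s s a) (join s s b) ≡
    (if [ (λ _ → true) , (λ _ → false) ]′ a xor [ (λ _ → true) , (λ _ → false) ]′ b then 1 else 0)
μ-completeBipartite s a b rewrite splitAt-join s s a | splitAt-join s s b = refl

≅-completeBipartite : {H : Graph N} {A B : Subset N} {s t : ℕ} → A ⊆ V H → B ⊆ V H → Disjoint A B →
  (∀ {a a′} → a ∈ A → a′ ∈ A → μ H a a′ ≡ 0) → (∀ {b b′} → b ∈ B → b′ ∈ B → μ H b b′ ≡ 0) →
  (∀ {a b} → a ∈ A → b ∈ B → μ H a b ≡ t) → ∣ A ∣ ≡ s → ∣ B ∣ ≡ s →
  H [ A ∪ B ] ≅ t · completeBipartite s
≅-completeBipartite {N} {H} {A} {B} {s} {t} A⊆ B⊆ disjoint A-indep B-indep full ∣A∣ ∣B∣ = record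
  { vertices  = mk↔ₛ′ (λ z → join s s (code z) , ∈⊤) (vertex ∘ splitAt s ∘ proj₁)
      (λ i → ∈-unique (trans (cong (join s s) (code-vertex (splitAt s (proj₁ i)))) (join-splitAt s s (proj₁ i))))
      (λ z → trans (cong vertex (splitAt-join s s (code z))) (vertex-code z))
  ; preserves = preserves
  }
  where
  K = H [ A ∪ B ]
  module EA = Inverse (subst (λ m → (∃[ x ] x ∈ A) ↔ Fin m) ∣A∣ (elements A))
  module EB = Inverse (subst (λ m → (∃[ x ] x ∈ B) ↔ Fin m) ∣B∣ (elements B))
  side : ((x , _) : Vertex K) → x ∈ A ⊎ x ∈ B
  side (_ , x∈) = x∈p∪q⁻ A B (p∩q⊆q (V H) (A ∪ B) x∈)
  code : Vertex K → Fin s ⊎ Fin s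
  code z = Sum.map (λ x∈ → EA.to (_ , x∈)) (λ x∈ → EB.to (_ , x∈)) (side z)
  vertex : Fin s ⊎ Fin s → Vertex K
  vertex (inj₁ i) with x , x∈ ← EA.from i = x , x∈p∩q⁺ (A⊆ x∈ , x∈p∪q⁺ (inj₁ x∈))
  vertex (inj₂ i) with x , x∈ ← EB.from i = x , x∈p∩q⁺ (B⊆ x∈ , x∈p∪q⁺ (inj₂ x∈))
  code-vertex : ∀ a → code (vertex a) ≡ a
  code-vertex (inj₁ i) with side (vertex (inj₁ i))
  ... | inj₁ x∈A = cong inj₁ (trans (cong EA.to (∈-unique refl)) (EA.strictlyInverseˡ i))
  ... | inj₂ x∈B = contradiction (_ , x∈p∩q⁺ (proj₂ (EA.from i) , x∈B)) disjoint
  code-vertex (inj₂ i) with side (vertex (inj₂ i))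
  ... | inj₂ x∈B = cong inj₂ (trans (cong EB.to (∈-unique refl)) (EB.strictlyInverseˡ i))
  ... | inj₁ x∈A = contradiction (_ , x∈p∩q⁺ (x∈A , proj₂ (EB.from i))) disjoint
  vertex-code : ∀ z → vertex (code z) ≡ z
  vertex-code z with side z
  ... | inj₁ x∈A = ∈-unique (cong proj₁ (EA.strictlyInverseʳ (_ , x∈A)))
  ... | inj₂ x∈B = ∈-unique (cong proj₁ (EB.strictlyInverseʳ (_ , x∈B)))
  preserves : ∀ y z → t * μ (completeBipartite s) (join s s (code y)) (join s s (code z)) ≡ μ K (proj₁ y) (proj₁ z)
  preserves y@(_ , y∈) z@(_ , z∈)
    rewrite μ-completeBipartite s (code y) (code z)
          | induced-∈ H (p∩q⊆q (V H) (A ∪ B) y∈) (p∩q⊆q (V H) (A ∪ B) z∈)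
    with side y | side z
  ... | inj₁ y∈A | inj₁ z∈A = trans (*-zeroʳ t) (sym (A-indep y∈A z∈A))
  ... | inj₁ y∈A | inj₂ z∈B = trans (*-identityʳ t) (sym (full y∈A z∈B))
  ... | inj₂ y∈B | inj₁ z∈A = trans (*-identityʳ t) (sym (trans (symmetric H _ _) (full z∈A y∈B)))
  ... | inj₂ y∈B | inj₂ z∈B = trans (*-zeroʳ t) (sym (B-indep y∈B z∈B))

∣∧<⇒≡0 : ∀ {d} → k ∣ d → d < k → d ≡ 0
∣∧<⇒≡0 {d = zero}  _   _   = refl
∣∧<⇒≡0 {d = suc _} k∣d d<k = contradiction k∣d (>⇒∤ d<k)

close-consecutive : ∀ {m n} → suc m ≤ k → n < k → k ∣ dist (suc m) n → suc m ≡ n ⊎ (suc m ≡ k × n ≡ 0)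
close-consecutive {m = m} {n} m<k n<k k∣ with ℕ.≤-total (suc m) n
... | inj₁ m<n = inj₁ (ℕ.∣m-n∣≡0⇒m≡n (∣∧<⇒≡0 k∣
  (ℕ.≤-<-trans (≤-reflexive (ℕ.m≤n⇒∣m-n∣≡n∸m m<n)) (ℕ.≤-<-trans (ℕ.m∸n≤m n (suc m)) n<k))))
close-consecutive         {n = zero}  m<k n<k k∣ | inj₂ _   = inj₂ (≤-antisym m<k (∣⇒≤ k∣) , refl)
close-consecutive {m = m} {n = suc n} m<k n<k k∣ | inj₂ n≤m = inj₁ (cong suc (ℕ.∣m-n∣≡0⇒m≡n (∣∧<⇒≡0 k∣
  (ℕ.≤-<-trans (≤-reflexive (ℕ.m≤n⇒∣n-m∣≡n∸m (s≤s⁻¹ n≤m))) (ℕ.≤-<-trans (ℕ.m∸n≤m m n) m<k)))))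

dist≡0⇒∣ : ∀ {m n} → m ≡ n → k ∣ dist m n
dist≡0⇒∣ {k} {m} refl = divides 0 (ℕ.m≡n⇒∣m-n∣≡0 {m} refl)

lift-neighbour : {i j : Fin k} → CyclicNeighbours k i j →
  ∃[ j′ ] (j′ ≡ j ↑ˡ k ⊎ j′ ≡ k ↑ʳ j) × CyclicNeighbours (k + k) (i ↑ˡ k) j′
lift-neighbour {k} {i} {j} (inj₁ k∣) with close-consecutive (toℕ<n i) (toℕ<n j) k∣
... | inj₁ eq rewrite toℕ-↑ˡ i k = j ↑ˡ k , inj₁ refl , inj₁ (dist≡0⇒∣ (trans eq (sym (toℕ-↑ˡ j k))))
... | inj₂ (eq , j≡0) rewrite toℕ-↑ˡ i k = k ↑ʳ j , inj₂ refl ,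
  inj₁ (dist≡0⇒∣ (trans eq (sym (trans (toℕ-↑ʳ k j) (trans (cong (k +_) j≡0) (+-identityʳ k))))))
lift-neighbour {k} {i} {j} (inj₂ k∣) with close-consecutive (toℕ<n j) (toℕ<n i) k∣
... | inj₁ eq rewrite toℕ-↑ˡ i k = j ↑ˡ k , inj₁ refl , inj₂ (dist≡0⇒∣ (trans (cong suc (toℕ-↑ˡ j k)) eq))
... | inj₂ (eq , i≡0) rewrite toℕ-↑ˡ i k | i≡0 = k ↑ʳ j , inj₂ refl ,
  inj₂ (subst (k + k ∣_) (sym (trans (cong suc (toℕ-↑ʳ k j))
    (trans (sym (ℕ.+-suc k (toℕ j))) (cong (k +_) eq)))) ∣-refl)

-- The copies of the x-vertex over v i and of its neighbour over v j already account
-- for all edges at v i and v j, and miss the copies of the other x-vertex over v i.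
inflatedDoubleCover-half : {G : Graph n} {t : ℕ} {v : Fin k → Fin n} {Y : Fin n → Subset N} {K : Graph N} →
  IsInflatedDoubleCover G t v Y K → ∀ {i j} → v i ∈ V G → v j ∈ V G → v i ≢ v j → CyclicNeighbours k i j →
  ∃[ C ] ∃[ D ] ∃[ q ] C ⊆ Y (v i) × D ⊆ Y (v j) × Nonempty C × (∀ {a b} → a ∈ C → b ∈ D → μ K a b ≡ q) ×
    ∣ C ∣ * q ≡ t × ∣ D ∣ * q ≡ t × ∃[ c ] c ∈ Y (v i) × c ∉ C
inflatedDoubleCover-half {n} {k} {G = G} {t} {v} {Y} {K} (_ , X , H , s , double , inflation)
                         {i} {j} vi∈ vj∈ vi≢vj near =
  I.copies x₁ , I.copies x₂ , _∣_.quotient (I.divides x₁ x₂) ,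
  copies⊆ vi∈ x₁∈ , copies⊆ vj∈ x₂∈ , nonempty x₁∈VH , I.edges x₁∈VH x₂∈VH x₁≢x₂ ,
  size x₁∈VH , size x₂∈VH ,
  proj₁ other , copies⊆ vi∈ x₃∈ (proj₂ other) ,
  λ c∈ → I.disjoint x₁∈VH x₃∈VH x₁≢x₃ (_ , x∈p∩q⁺ (c∈ , proj₂ other))
  where
  open IsDoubleCover double
  module I = IsInflation inflation
  lifted = lift-neighbour near
  j′ = proj₁ lifted
  x₁ = x (i ↑ˡ k)
  x₂ = x j′
  x₃ = x (k ↑ʳ i)
  first : ∀ i → x (i ↑ˡ k) ∈ X (v i)
  first i = subst (x (i ↑ˡ k) ∈_) (sym (pairs i)) (x∈p∪q⁺ (inj₁ (x∈⁅x⁆ _)))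
  second : ∀ i → x (k ↑ʳ i) ∈ X (v i)
  second i = subst (x (k ↑ʳ i) ∈_) (sym (pairs i)) (x∈p∪q⁺ (inj₂ (x∈⁅x⁆ _)))
  x₁∈ = first i
  x₃∈ = second i
  x₂∈ : x₂ ∈ X (v j)
  x₂∈ with proj₁ (proj₂ lifted)
  ... | inj₁ eq = subst (λ l → x l ∈ X (v j)) (sym eq) (first j)
  ... | inj₂ eq = subst (λ l → x l ∈ X (v j)) (sym eq) (second j)
  x₁∈VH = parts⊆ isCover vi∈ x₁∈
  x₂∈VH = parts⊆ isCover vj∈ x₂∈
  x₃∈VH = parts⊆ isCover vi∈ x₃∈
  x₁≢x₂ : x₁ ≢ x₂
  x₁≢x₂ eq = IsCover.disjoint isCover vi∈ vj∈ vi≢vj (_ , x∈p∩q⁺ (x₁∈ , subst (_∈ X (v j)) (sym eq) x₂∈))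
  x₁≢x₃ : x₁ ≢ x₃
  x₁≢x₃ eq = ℕ.<⇒≢ (ℕ.<-≤-trans (toℕ<n i) (ℕ.m≤m+n k (toℕ i)))
    (trans (sym (toℕ-↑ˡ i k)) (trans (cong toℕ (injective eq)) (toℕ-↑ʳ k i)))
  copies⊆ : ∀ {w y} → w ∈ V G → y ∈ X w → I.copies y ⊆ Y w
  copies⊆ w∈ y∈ a∈ = Equivalence.from (I.parts w∈ _) (_ , y∈ , a∈)
  nonempty : ∀ {y} → y ∈ V H → Nonempty (I.copies y)
  nonempty y∈ = ∣∣≥1⇒nonempty _ (subst (1 ≤_) (sym (I.size y∈)) I.positive)
  other = nonempty x₃∈VH
  size : ∀ {y} → y ∈ V H → ∣ I.copies y ∣ * _∣_.quotient (I.divides x₁ x₂) ≡ t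
  size y∈ = trans (cong (_* _) (I.size y∈)) (trans (*-comm s _)
    (trans (sym (_∣_.equality (I.divides x₁ x₂))) (edges _ _ (proj₂ (proj₂ lifted)))))

module _ {G : Graph n} {X : Fin n → Subset N} {H : Graph N} {f : Fin N → ℕ} {u v : Fin n}
         (u∈ : u ∈ V G) (v∈ : v ∈ V G) (u≢v : u ≢ v) (one : OnlyOneComponent (H [ X u ∪ X v ])) where

  private
    part-nonempty : IsUniform G X H → ∀ {w} → w ∈ V G → Nonempty (X w)
    part-nonempty uniform w∈ with r , 1≤r , size ← IsUniform.size uniform =
      ∣∣≥1⇒nonempty _ (subst (1 ≤_) (sym (size w∈)) 1≤r)

    two-inflated-absurd : IsUniform G X H → ∀ {U U′} → Disjoint U U′ →
      IsInflatedGCover G (X ↾ U) (H [ U ]) → ¬ IsInflatedGCover G (X ↾ U′) (H [ U′ ])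
    two-inflated-absurd uniform disjoint inflated inflated′ with a , a∈ ← part-nonempty uniform u∈ =
      disjoint (a , x∈p∩q⁺ (inflated-everything uniform inflated u∈ v∈ u≢v one u∈ a∈ ,
                            inflated-everything uniform inflated′ u∈ v∈ u≢v one u∈ a∈))

  kConfiguration⇒mConfiguration : IsBlock G → IsKConfiguration G X H f → IsMConfiguration G X H f
  kConfiguration⇒mConfiguration isBlock
    record { p = suc (suc _) ; isUniform = uniform ; disjoint = disjoint ; inflated = inflated } =
    contradiction (inflated (suc zero)) (two-inflated-absurd uniform (disjoint {zero} (λ ())) (inflated zero))
  kConfiguration⇒mConfiguration isBlock
    record { isUniform = uniform ; t = t ; G≅tK = G≅tK ; p = suc zero ; ns = ns ; sum-ns = refl ; U = U ; U⊆VH = U⊆VH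
           ; inflated = inflated ; f-inside = f-inside ; f-outside = f-outside } = record
    { isUniform = uniform
    ; isBlock   = isBlock
    ; U         = U zero
    ; U⊆VH      = U⊆VH zero
    ; inflated  = inflated zero
    ; f-inside  = λ w∈ x∈ x∈U → trans (f-inside w∈ x∈ zero x∈U)
        (trans (cong (t *_) (sym (+-identityʳ (ns zero)))) (sym (degree-complete {t = t} G≅tK w∈)))
    ; f-outside = λ w∈ x∈ x∉U → f-outside w∈ x∈ λ { zero → x∉U }
    }

  ¬oddCConfiguration : ¬ IsOddCConfiguration G X H f
  ¬oddCConfiguration odd =
    two-inflated-absurd isUniform (disjoint {zero} {suc zero} (λ ())) (inflated zero) (inflated (suc zero))
    where open IsOddCConfiguration odd

  ¬evenCConfiguration : ¬ IsEvenCConfiguration G X H f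
  ¬evenCConfiguration C = absurd (cyclicNeighbours? h i j)
    where
    open IsEvenCConfiguration C hiding (v) renaming (k to h)
    open _≅_ G≅tC
    open Inverse vertices
    cyc = IsEvenCConfiguration.v C
    i j : Fin h
    i = proj₁ (to (u , u∈))
    j = proj₁ (to (v , v∈))
    from-to : ∀ {w} (w∈ : w ∈ V G) → cyc (proj₁ (to (w , w∈))) ≡ w
    from-to w∈ = cong proj₁ (trans (cong from (∈-unique {b = to (_ , w∈)} refl)) (strictlyInverseʳ (_ , w∈)))
    absurd : ¬ Dec (CyclicNeighbours h i j)
    absurd (no ¬near) = let b , b∈ = part-nonempty isUniform v∈ in ∉⊥ (proj₂
      (saturated-pair (IsUniform.isCover isUniform) {q = 0} u∈ v∈ u≢v one {D = ⊥}
        (λ a∈ → a∈) (λ b∈ → contradiction b∈ ∉⊥)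
        (part-nonempty isUniform u∈) (λ _ b∈ → contradiction b∈ ∉⊥)
        (trans (*-zeroʳ ∣ X u ∣) (sym μ≡0)) (trans (*-zeroʳ ∣ ⊥ {N} ∣) (sym μ≡0))) b∈)
      where
      μ≡0 : μ G u v ≡ 0
      μ≡0 = trans (sym (preserves (u , u∈) (v , v∈)))
        (trans (cong (λ b → t * (if b then 1 else 0)) (dec-false (cyclicNeighbours? h i j) ¬near)) (*-zeroʳ t))
    absurd (yes near)
      with A , D , q , A⊆ , D⊆ , nonempty , full , ∣A∣q , ∣D∣q , c , c∈ , c∉A ←
        inflatedDoubleCover-half inflated (subst (_∈ V G) (sym (from-to u∈)) u∈)
          (subst (_∈ V G) (sym (from-to v∈)) v∈)
          (λ eq → u≢v (trans (sym (from-to u∈)) (trans eq (from-to v∈)))) near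
      rewrite from-to u∈ | from-to v∈ =
      c∉A (proj₁ (saturated-pair (IsUniform.isCover isUniform) u∈ v∈ u≢v one
        (p∩q⊆p (X u) U ∘ A⊆) (p∩q⊆p (X v) U ∘ D⊆) nonempty
        (λ a∈ b∈ → trans (sym (induced-∈ H (p∩q⊆q (X u) U (A⊆ a∈)) (p∩q⊆q (X v) U (D⊆ b∈)))) (full a∈ b∈))
        (trans ∣A∣q (sym μ≡t)) (trans ∣D∣q (sym μ≡t))) (p∩q⊆p (X u) U c∈))
      where
      μ≡t : μ G u v ≡ t
      μ≡t = trans (sym (preserves (u , u∈) (v , v∈)))
        (trans (cong (λ b → t * (if b then 1 else 0)) (dec-true (cyclicNeighbours? h i j) near)) (*-identityʳ t))

  connected⇒mConfiguration : IsBlock G →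
    IsMConfiguration G X H f ⊎ IsKConfiguration G X H f ⊎ IsCConfiguration G X H f → IsMConfiguration G X H f
  connected⇒mConfiguration isBlock (inj₁ M)               = M
  connected⇒mConfiguration isBlock (inj₂ (inj₁ K))        = kConfiguration⇒mConfiguration isBlock K
  connected⇒mConfiguration isBlock (inj₂ (inj₂ (inj₁ C))) = contradiction C ¬oddCConfiguration
  connected⇒mConfiguration isBlock (inj₂ (inj₂ (inj₂ C))) = contradiction C ¬evenCConfiguration

  mConfiguration-complete : IsMConfiguration G X H f →
    ∃[ s ] 1 ≤ s × (∀ {w} → w ∈ V G → ∣ X w ∣ ≡ s) ×
    (∀ {w z} → w ∈ V G → z ∈ V G → w ≢ z →
      ∃[ q ] s * q ≡ μ G w z × (∀ {a b} → a ∈ X w → b ∈ X z → μ H a b ≡ q))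
  mConfiguration-complete M with s , 1≤s , sizes , dense ← inflatedGCover-complete (IsMConfiguration.inflated M) =
    s , 1≤s , (λ {w} w∈ → trans (cong ∣_∣ (⊆-antisym (in-U w∈) (p∩q⊆p (X w) U))) (sizes w∈)) , λ w∈ z∈ w≢z →
      let q , sq , full = dense w∈ z∈ w≢z in
      q , sq , λ a∈ b∈ → trans (sym (induced-∈ H (⊆U w∈ a∈) (⊆U z∈ b∈))) (full (in-U w∈ a∈) (in-U z∈ b∈))
    where
    open IsMConfiguration M
    ⊆U : ∀ {w} → w ∈ V G → X w ⊆ U
    ⊆U = inflated-everything isUniform inflated u∈ v∈ u≢v one
    in-U : ∀ {w} → w ∈ V G → X w ⊆ (X ↾ U) w
    in-U w∈ x∈ = x∈p∩q⁺ (x∈ , ⊆U w∈ x∈)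

onlyOneComponent-induced : {H : Graph N} {A W : Subset N} → A ⊆ W →
  OnlyOneComponent (H [ A ]) → OnlyOneComponent ((H [ W ]) [ A ])
onlyOneComponent-induced {H = H} {A} {W} A⊆W ((a , a∈) , linked) =
  (a , into a∈) , λ x∈ y∈ → map keep (linked (back x∈) (back y∈))
  where
  into : V (H [ A ]) ⊆ V ((H [ W ]) [ A ])
  into x∈ with x∈H , x∈A ← x∈p∩q⁻ (V H) A x∈ = x∈p∩q⁺ (x∈p∩q⁺ (x∈H , A⊆W x∈A) , x∈A)
  back : V ((H [ W ]) [ A ]) ⊆ V (H [ A ])
  back x∈ with x∈HW , x∈A ← x∈p∩q⁻ (V H ∩ W) A x∈ = x∈p∩q⁺ (p∩q⊆p (V H) W x∈HW , x∈A)
  keep : ∀ {x y} → μ (H [ A ]) x y ≢ 0 → μ ((H [ W ]) [ A ]) x y ≢ 0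
  keep μ≢0 eq with x∈ , y∈ ← induced-support H μ≢0 =
    μ≢0 (trans (induced-∈ H x∈ y∈) (trans (sym (induced-∈ H (A⊆W x∈) (A⊆W y∈)))
      (trans (sym (induced-∈ (H [ W ]) x∈ y∈)) eq)))

module _ {B G : Graph n} (isB : IsBlockOf B G) {X : Fin n → Subset N} {H : Graph N} {W : Subset N} {f : Fin N → ℕ}
         (⊆W : ∀ {w} → w ∈ V B → X w ⊆ W) {u v : Fin n} (u∈ : u ∈ V B) (v∈ : v ∈ V B) (u≢v : u ≢ v)
         (one : OnlyOneComponent (H [ X u ∪ X v ])) where

  private
    oneᵂ : OnlyOneComponent (H [ W ] [ X u ∪ X v ])
    oneᵂ = onlyOneComponent-induced {H = H} ([ ⊆W u∈ , ⊆W v∈ ]′ ∘ x∈p∪q⁻ (X u) (X v)) one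

  block-mConfiguration :
    IsMConfiguration B X (H [ W ]) f ⊎ IsKConfiguration B X (H [ W ]) f ⊎ IsCConfiguration B X (H [ W ]) f →
    IsMConfiguration B X (H [ W ]) f
  block-mConfiguration = connected⇒mConfiguration u∈ v∈ u≢v oneᵂ (nonseparable⇒isBlock (IsBlockOf.nonseparable isB))

  block-completeBipartite : IsMConfiguration B X (H [ W ]) f →
    ∀ {w z} → w ∈ V B → z ∈ V B → w ≢ z → ∀ {m} → μ G w z ≡ m → 0 < m →
    ∃[ s ] ∃[ t ] 1 ≤ s × 1 ≤ t × H [ X w ∪ X z ] ≅ t · completeBipartite s × m ≡ t * s
  block-completeBipartite M {w} {z} w∈ z∈ w≢z {m} μ≡m 0<m
    with s , 1≤s , sizes , dense ← mConfiguration-complete u∈ v∈ u≢v oneᵂ M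
    with t , st , full ← dense w∈ z∈ w≢z =
    s , t , 1≤s , ℕ.n≢0⇒n>0 (λ { refl → ℕ.<⇒≢ 0<m (sym m≡) }) ,
    ≅-completeBipartite (⊆VH w∈) (⊆VH z∈) (IsCover.disjoint cover w∈ z∈ w≢z) (indep w∈) (indep z∈)
      (λ a∈ b∈ → trans (sym (μᵂ w∈ z∈ a∈ b∈)) (full a∈ b∈)) (sizes w∈) (sizes z∈) ,
    m≡
    where
    cover = IsUniform.isCover (IsMConfiguration.isUniform M)
    ⊆VH : ∀ {w} → w ∈ V B → X w ⊆ V H
    ⊆VH w∈ = p∩q⊆p (V H) W ∘ parts⊆ cover w∈
    μᵂ : ∀ {w z} → w ∈ V B → z ∈ V B → ∀ {a b} → a ∈ X w → b ∈ X z → μ (H [ W ]) a b ≡ μ H a b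
    μᵂ w∈ z∈ a∈ b∈ = induced-∈ H (⊆W w∈ a∈) (⊆W z∈ b∈)
    indep : ∀ {w} → w ∈ V B → ∀ {a b} → a ∈ X w → b ∈ X w → μ H a b ≡ 0
    indep w∈ a∈ b∈ = trans (sym (μᵂ w∈ w∈ a∈ b∈)) (IsCover.independent cover w∈ a∈ b∈)
    m≡ : m ≡ t * s
    m≡ = trans (sym μ≡m) (trans (sym (block-induced isB w∈ z∈)) (trans (sym st) (*-comm s t)))

⊆⋃ : {W : Subset n} {X : Fin n → Subset N} {w : Fin n} → w ∈ W → X w ⊆ ⋃[ W ] X
⊆⋃ {W = W} {X} {w} w∈ {x} x∈ = lookup⇒[]= x (⋃[ W ] X)
  (trans (lookup∘tabulate _ x) (dec-true (any? λ v → v ∈? W ×-dec x ∈? X v) (w , w∈ , x∈)))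

proposition10 : ∀ {n N} {G : Graph n} {X : Fin n → Subset N} {H : Graph N} {f : Fin N → ℕ} →
    Constructible G X H f →
    ∀ {part : Subset n → Fin N → ℕ} → AreParts G X H f part →
    ∀ {B : Graph n} → IsBlockOf B G →
    (∃[ u ] ∃[ v ] u ∈ V B × v ∈ V B × u ≢ v × OnlyOneComponent (H [ X u ∪ X v ])) →
    IsMConfiguration B X (H [ ⋃[ V B ] X ]) (part (V B)) ×
    (∀ {u v} → u ∈ V B → v ∈ V B → u ≢ v → ∀ {m} → μ G u v ≡ m → 0 < m →
    ∃[ s ] ∃[ t ] 1 ≤ s × 1 ≤ t × H [ X u ∪ X v ] ≅ t · completeBipartite s × m ≡ t * s)
proposition10 {X = X} {H} _ {part} parts {B} isB (u , v , u∈ , v∈ , u≢v , one) =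
  M , block-completeBipartite isB {H = H} (⊆⋃ {W = V B} {X = X}) u∈ v∈ u≢v one M
  where
  M : IsMConfiguration B X (H [ ⋃[ V B ] X ]) (part (V B))
  M = block-mConfiguration isB {H = H} (⊆⋃ {W = V B} {X = X}) u∈ v∈ u≢v one (AreParts.isMKC parts isB)
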